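{- Let $G=(V,E)$ be a graph with edge coloring $\mathcal{C}:E\to C$ and let $S\subseteq V$ be a set of terminals. Suppose a Tutte set $A$ exists. Let $s\in S$ be a terminal, let $H$ be a connected component of $G-A$ containing the vertex $t$ but not $s$, and assume that there is no mismatched edge with an endpoint in $H$. Then there is no alternating $s$-$t$ trail in $G$. In particular (whenever a Tutte set exists), there is no alternating trail connecting distinct terminals, i.e. no alternating $s$-$s'$ trail with $s,s'\in S$, $s\neq s'$.
   Context: Graphs are finite and undirected; parallel edges are allowed, loops are not. Colors come from a set $C$ with $\#C\ge 2$. A $v_0$-$v_m$ walk is a sequence $W=(v_0,e_1,v_1,\ldots,e_m,v_m)$, $m\ge 0$, where each $e_j\in E$ has endpoints $v_{j-1},v_j$ (vertices and edges may repeat). It is a trail when $e_1,\ldots,e_m$ are distinct. It is closed when $v_0=v_m$. It is internally alternating when $\mathcal{C}(e_j)\ne\mathcal{C}(e_{j+1})$ for $j=1,\ldots,m-1$, and alternating when in addition, if $W$ is closed, $\mathcal{C}(e_m)\ne \mathcal{C}(e_1)$ (so for $v_0\neq v_m$ the two notions coincide). Tutte set: a subset $A\subseteq V-S$ is a Tutte set (with respect to $G,\mathcal{C},S$) when (i) each component of $G-A$ contains at most one terminal; and (ii) $A$ can be written as a disjoint union $A=\dot\bigcup_{c\in C}A(c)$ (empty blocks allowed) such that conditions (a), (b), (c) below hold. A vertex $u\in A$ has color $c$ if $u\in A(c)$. An edge $e$ is mismatched if either $e$ connects some $u\in A$ with some $v\in V-A$ and $\mathcal{C}(e)$ differs from the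 color of $u$, or $e$ connects two vertices $u,v\in A$ and $\mathcal{C}(e)$ differs from both the color of $u$ and the color of $v$. Conditions: (a) if $H$ is a component of $G-A$ containing a terminal, then there is no mismatched edge with an endpoint in $H$; (b) if $H$ is a component of $G-A$ containing no terminal, then there is at most one mismatched edge with an endpoint in $H$; (c) there are no mismatched edges with both endpoints in $A$. "A Tutte set $A$" comes with a fixed such decomposition, and mismatched edges are with respect to it. -}

module Defs where

open import Data.Fin.Base using (Fin)
open import Data.Fin.Subset using (Subset; _∈_; _∉_; _⊆_; ∁; _∩_; Empty)
open import Data.List.Base using (List; []; _∷_; head; last)
open import Data.List.Relation.Unary.Linked using (Linked)
open import Data.List.Relation.Unary.Unique.Propositional using (Unique)
open import Data.Maybe.Base using (just)
open import Data.Nat.Base using (ℕ)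
open import Data.Product.Base using (∃; ∃-syntax; _×_; _,_; proj₁; proj₂)
open import Data.Sum.Base using (_⊎_)
open import Function.Bundles using (_⇔_)
open import Level using (Level; 0ℓ; _⊔_) renaming (suc to lsuc)
open import Relation.Binary.Construct.Closure.ReflexiveTransitive using (Star)
open import Relation.Binary.PropositionalEquality using (_≡_; _≢_)
open import Relation.Nullary.Negation using (¬_)
open import Relation.Unary using (Pred)

-- Finite graphs with parallel edges and without loops.  The order of the two
-- components of `ends e` carries no meaning: graphs are only used through the
-- symmetric relation `Connects` below.
record Graph : Set where
  field
    order    : ℕ
    size     : ℕ
    ends     : Fin size → Fin order × Fin order
    loopless : ∀ e → proj₁ (ends e) ≢ proj₂ (ends e)

  V : Set
  V = Fin order

  E : Set
  E = Fin size

  Connects : E → V → V → Set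
  Connects e u v = ends e ≡ (u , v) ⊎ ends e ≡ (v , u)

module _ (G : Graph) where
  open Graph G

  data Walk : V → V → Set where
    []  : ∀ {v} → Walk v v
    _∷_ : ∀ {u v w} → (∃[ e ] Connects e u v) → Walk v w → Walk u w

  edges : ∀ {u v} → Walk u v → List E
  edges []            = []
  edges ((e , _) ∷ W) = e ∷ edges W

  IsTrail : ∀ {u v} → Walk u v → Set
  IsTrail W = Unique (edges W)

  AdjacentAvoiding : Subset order → V → V → Set
  AdjacentAvoiding A u v = u ∉ A × v ∉ A × ∃[ e ] Connects e u v

  -- H is the vertex set of a component of G - A, that is, the set of all
  -- vertices that can be reached in G - A from some vertex r of G - A.
  IsComponent : Subset order → Pred V 0ℓ → Set
  IsComponent A H =
    ∃[ r ] r ∉ A × (∀ v → H v ⇔ Star (AdjacentAvoiding A) r v)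

  HasEndpointIn : E → Pred V 0ℓ → Set
  HasEndpointIn e H = ∃[ u ] ∃[ v ] Connects e u v × H u

-- A disjoint union of blocks indexed by the colors; blocks may be empty.
record Decomposition {ℓ : Level} (Color : Set ℓ) {n : ℕ} (A : Subset n) : Set ℓ where
  field
    block    : Color → Subset n
    union    : ∀ v → v ∈ A ⇔ (∃[ c ] v ∈ block c)
    disjoint : ∀ c d → c ≢ d → Empty (block c ∩ block d)

module _ {ℓ : Level} {Color : Set ℓ} (G : Graph) (col : Graph.E G → Color) where
  open Graph G

  IsInternallyAlternating : ∀ {u v} → Walk G u v → Set ℓ
  IsInternallyAlternating W = Linked (λ e f → col e ≢ col f) (edges G W)

  -- The second condition is void for the closed walk without edges.
  IsAlternating : ∀ {u v} → Walk G u v → Set ℓ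
  IsAlternating {u} {v} W =
    IsInternallyAlternating W ×
    (u ≡ v → ∀ e f → head (edges G W) ≡ just e → last (edges G W) ≡ just f →
     col f ≢ col e)

  AlternatingTrail : V → V → Set ℓ
  AlternatingTrail u v = ∃ λ (W : Walk G u v) → IsTrail G W × IsAlternating W

  module _ {A : Subset order} (D : Decomposition Color A) where
    open Decomposition D

    data Mismatched (e : E) : Set ℓ where
      leaving : ∀ {u v c} → Connects e u v → u ∈ A → v ∉ A →
                u ∈ block c → col e ≢ c → Mismatched e
      inside  : ∀ {u v c d} → Connects e u v → u ∈ A → v ∈ A →
                u ∈ block c → v ∈ block d → col e ≢ c → col e ≢ d → Mismatched e

    record IsTutteSet (S : Subset order) : Set (lsuc 0ℓ ⊔ ℓ) where
      field
        avoids-terminals : A ⊆ ∁ S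
        at-most-one-terminal :
          ∀ H → IsComponent G A H →
          ∀ s s′ → s ∈ S → s′ ∈ S → H s → H s′ → s ≡ s′
        terminal-component :
          ∀ H → IsComponent G A H → (∃[ s ] s ∈ S × H s) →
          ∀ e → Mismatched e → ¬ HasEndpointIn G e H
        terminal-free-component :
          ∀ H → IsComponent G A H → ¬ (∃[ s ] s ∈ S × H s) →
          ∀ e f → Mismatched e → HasEndpointIn G e H →
          Mismatched f → HasEndpointIn G f H → e ≡ f
        none-inside :
          ∀ e u v → Connects e u v → u ∈ A → v ∈ A → ¬ Mismatched e

{-# OPTIONS --safe #-}

-- Follow an alternating trail from the terminal s.  Whenever it visits a vertex
-- of A of color c, the edge it arrived by has color c, so the edge it leaves by
-- does not; hence every entry from A into a component of G - A uses a mismatched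
-- edge.  Such a component has no further mismatched edge, and the component of s
-- has none at all, so an edge leading back to A has the color of its endpoint in
-- A.  Thus only the component of s and components with a mismatched edge are
-- ever visited.

module Submission where

open import Defs
open import Data.Empty using (⊥)
open import Data.Fin.Subset using (Subset; _∈_; _∉_)
open import Data.Fin.Subset.Properties using (_∈?_; x∈p⇒x∉∁p)
open import Data.List.Base using (_∷_)
open import Data.List.Relation.Unary.All as All using (All)
open import Data.List.Relation.Unary.AllPairs using (_∷_)
open import Data.List.Relation.Unary.Linked as Linked using (Linked; _∷_)
open import Data.Product.Base using (∃₂; ∃-syntax; _×_; _,_)
open import Data.Sum.Base using (_⊎_; inj₁; inj₂; swap)
open import Function.Base using (id)
open import Function.Bundles using (module Equivalence; mk⇔)
open import Level using (Level; 0ℓ)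
open import Relation.Binary.Construct.Closure.ReflexiveTransitive
  using (Star; ε; _◅_; _◅◅_; reverse)
open import Relation.Binary.PropositionalEquality using (_≡_; _≢_; sym; subst)
open import Relation.Nullary.Decidable.Core using (yes; no)
open import Relation.Nullary.Negation using (¬_)
open import Relation.Unary using (Pred)

open Equivalence using (to; from)

module _ (G : Graph) (A : Subset (Graph.order G)) where
  open Graph G

  Reach : V → V → Set
  Reach = Star (AdjacentAvoiding G A)

  Reach-sym : ∀ {u v} → Reach u v → Reach v u
  Reach-sym = reverse λ (u∉A , v∉A , e , uv) → v∉A , u∉A , e , swap uv

  Reach-avoids : ∀ {u v} → u ∉ A → Reach u v → v ∉ A
  Reach-avoids u∉A ε                     = u∉A
  Reach-avoids _   ((_ , w∉A , _) ◅ w⇝v) = Reach-avoids w∉A w⇝v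

  Reach-isComponent : ∀ {v} → v ∉ A → IsComponent G A (Reach v)
  Reach-isComponent {v} v∉A = v , v∉A , λ _ → mk⇔ id id

  HasEndpointIn-resp-Reach : ∀ {e u v} → Reach u v →
    HasEndpointIn G e (Reach u) → HasEndpointIn G e (Reach v)
  HasEndpointIn-resp-Reach u⇝v (x , y , xy , u⇝x) =
    x , y , xy , (Reach-sym u⇝v ◅◅ u⇝x)

module _ {ℓ : Level} {Color : Set ℓ} (G : Graph) (col : Graph.E G → Color)
         (S A : Subset (Graph.order G)) (D : Decomposition Color A)
         (tutte : IsTutteSet G col D S) where
  open Graph G
  open Decomposition D
  open IsTutteSet tutte

  private
    _⇝_ : V → V → Set
    _⇝_ = Reach G A

  terminal∉A : ∀ {s} → s ∈ S → s ∉ A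
  terminal∉A s∈S s∈A = x∈p⇒x∉∁p s∈S (avoids-terminals s∈A)

  block⊆A : ∀ {v c} → v ∈ block c → v ∈ A
  block⊆A v∈c = from (union _) (_ , v∈c)

  no-mismatch-at-terminal : ∀ {s e} → s ∈ S → Mismatched G col D e →
    ¬ HasEndpointIn G e (s ⇝_)
  no-mismatch-at-terminal s∈S mis =
    terminal-component _ (Reach-isComponent G A (terminal∉A s∈S)) (_ , s∈S , ε) _ mis

  -- The mismatched edge `e` itself rules out a terminal in the component of `v`, so the bound for
  -- terminal-free components applies.
  mismatch-unique : ∀ {v e f} → v ∉ A →
    Mismatched G col D e → HasEndpointIn G e (v ⇝_) →
    Mismatched G col D f → HasEndpointIn G f (v ⇝_) → e ≡ f
  mismatch-unique v∉A mis-e e-at-v =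
    terminal-free-component _ component
      (λ terminal → terminal-component _ component terminal _ mis-e e-at-v)
      _ _ mis-e e-at-v
    where component = Reach-isComponent G A v∉A

  module _ {s t : V} (s∈S : s ∈ S) (t∉A : t ∉ A) (¬s⇝t : ¬ s ⇝ t)
           (no-mismatch-at-t : ∀ {e} → Mismatched G col D e →
                               ¬ HasEndpointIn G e (t ⇝_)) where

    -- How the part of the trail before v got into the component of v; W is the
    -- part still to come.
    Entered : ∀ {v} → Walk G v t → Set ℓ
    Entered {v} W =
      s ⇝ v ⊎
      (∃[ f ] Mismatched G col D f × HasEndpointIn G f (v ⇝_) × All (f ≢_) (edges G W))

    -- Here `f` is the edge just traversed to reach `v`; prepending it keeps the color condition at
    -- `v` after the trail is cut there.
    Alternates : ∀ {v} → E → Walk G v t → Set ℓ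
    Alternates f W = Linked (λ e g → col e ≢ col g) (f ∷ edges G W)

    -- A mismatched exit is impossible in the component of `s`; in any other it would have to be the
    -- entering edge again, which a trail cannot repeat. Equality of colors need not be decidable,
    -- hence the double negation.
    exit-matched : ∀ {v w e} {vw : Connects e v w} {W : Walk G w t} → v ∉ A → w ∈ A →
      Entered ((e , vw) ∷ W) → ∀ {c} → w ∈ block c → ¬ col e ≢ c
    exit-matched {v} {w} {e} {vw} v∉A w∈A entered w∈c col≢c = absurd entered
      where
      mis : Mismatched G col D e
      mis = leaving (swap vw) w∈A v∉A w∈c col≢c

      e-at-v : HasEndpointIn G e (v ⇝_)
      e-at-v = v , w , vw , ε

      absurd : Entered ((e , vw) ∷ _) → ⊥
      absurd (inj₁ s⇝v) = no-mismatch-at-terminal s∈S mis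
        (HasEndpointIn-resp-Reach G A (Reach-sym G A s⇝v) e-at-v)
      absurd (inj₂ (_ , mis-f , f-at-v , f≢e All.∷ _)) =
        f≢e (mismatch-unique v∉A mis-f f-at-v mis e-at-v)

    Entered-step : ∀ {v w e} {vw : Connects e v w} {W : Walk G w t} → v ∉ A → w ∉ A →
      Entered ((e , vw) ∷ W) → Entered W
    Entered-step {e = e} {vw} v∉A w∉A entered = move entered
      where
      v⇝w : _ ⇝ _
      v⇝w = (v∉A , w∉A , e , vw) ◅ ε

      move : Entered ((e , vw) ∷ _) → Entered _
      move (inj₁ s⇝v) = inj₁ (s⇝v ◅◅ v⇝w)
      move (inj₂ (f , mis-f , f-at-v , _ All.∷ f∉W)) =
        inj₂ (f , mis-f , HasEndpointIn-resp-Reach G A v⇝w f-at-v , f∉W)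

    -- Mutual induction on the remaining walk. At its end `t`, either alternative of `Entered`
    -- contradicts an assumption on the component of `t`.
    no-trail-from-outside : ∀ {v} (W : Walk G v t) → IsTrail G W →
      IsInternallyAlternating G col W → v ∉ A → ¬ Entered W

    no-trail-from-A : ∀ {v f} (W : Walk G v t) → IsTrail G W →
      Alternates f W → ¬ v ∈ block (col f)

    no-trail-from-outside [] _ _ _ (inj₁ s⇝t) = ¬s⇝t s⇝t
    no-trail-from-outside [] _ _ _ (inj₂ (_ , mis , at-t , _)) = no-mismatch-at-t mis at-t
    no-trail-from-outside (_∷_ {v = w} (e , vw) W) (e∉W ∷ trail) alt v∉A entered
      with w ∈? A
    ... | no w∉A = no-trail-from-outside W trail (Linked.tail alt) w∉A
                     (Entered-step {vw = vw} v∉A w∉A entered)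
    ... | yes w∈A with to (union w) w∈A
    -- The goal is absurdity, so the rest of the trail can be treated under the assumption that `e`
    -- has the color of `w`.
    ...   | c , w∈c = exit-matched {vw = vw} {W} v∉A w∈A entered w∈c λ col≡c →
              no-trail-from-A W trail alt (subst (λ d → w ∈ block d) (sym col≡c) w∈c)

    no-trail-from-A [] _ _ t∈c = t∉A (block⊆A t∈c)
    no-trail-from-A (_∷_ {v = w} (e , vw) W) (e∉W ∷ trail) (f≢e ∷ alt) v∈c
      with w ∈? A
    -- The arrival edge has the color of `v`, so `e` does not and is mismatched. It becomes the
    -- recorded entering edge, and `e∉W` forbids its reuse.
    ... | no w∉A = no-trail-from-outside W trail (Linked.tail alt) w∉A
            (inj₂ (e , leaving vw (block⊆A v∈c) w∉A v∈c (λ eq → f≢e (sym eq))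
                     , (w , _ , swap vw , ε) , e∉W))
    ... | yes w∈A with to (union w) w∈A
    -- Since `e` already misses the color of `v`, it must match that of `w`, or it would be
    -- mismatched inside `A`.
    ...   | d , w∈d = none-inside e _ w vw v∈A w∈A
              (inside vw v∈A w∈A v∈c w∈d (λ eq → f≢e (sym eq)) λ col≡d →
                no-trail-from-A W trail alt (subst (λ d → w ∈ block d) (sym col≡d) w∈d))
      where v∈A = block⊆A v∈c

    no-alternating-trail : ¬ AlternatingTrail G col s t
    no-alternating-trail (W , trail , alt , _) =
      no-trail-from-outside W trail alt (terminal∉A s∈S) (inj₁ ε)

theorem2p2 : {ℓ : Level} {Color : Set ℓ} → (∃₂ λ (c d : Color) → c ≢ d) →
    (G : Graph) (col : Graph.E G → Color) (S : Subset (Graph.order G)) →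
    (A : Subset (Graph.order G)) (D : Decomposition Color A) →
    IsTutteSet G col D S →
    (∀ (s t : Graph.V G) (H : Pred (Graph.V G) 0ℓ) →
    s ∈ S → IsComponent G A H → H t → ¬ H s →
    (∀ e → Mismatched G col D e → ¬ HasEndpointIn G e H) →
    ¬ AlternatingTrail G col s t)
    ×
    (∀ (s s′ : Graph.V G) → s ∈ S → s′ ∈ S → s ≢ s′ →
    ¬ AlternatingTrail G col s s′)
theorem2p2 _ G col S A D tutte = avoiding-component , avoiding-terminal
  where
  open IsTutteSet tutte

  avoiding-component : ∀ s t (H : Pred (Graph.V G) 0ℓ) →
    s ∈ S → IsComponent G A H → H t → ¬ H s →
    (∀ e → Mismatched G col D e → ¬ HasEndpointIn G e H) →
    ¬ AlternatingTrail G col s t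
  avoiding-component s t H s∈S (r , r∉A , H⇔) t∈H s∉H no-mismatch =
    -- `H` is described from its root `r`; the path from `r` to `t` makes it the component of `t`.
    no-alternating-trail G col S A D tutte s∈S (Reach-avoids G A r∉A r⇝t)
      (λ s⇝t → s∉H (from (H⇔ s) (r⇝t ◅◅ Reach-sym G A s⇝t)))
      (λ mis (u , v , uv , t⇝u) →
        no-mismatch _ mis (u , v , uv , from (H⇔ u) (r⇝t ◅◅ t⇝u)))
    where r⇝t = to (H⇔ t) t∈H

  -- Distinct terminals lie in different components, and that of `s′`, having a terminal, meets no
  -- mismatched edge.
  avoiding-terminal : ∀ s s′ → s ∈ S → s′ ∈ S → s ≢ s′ → ¬ AlternatingTrail G col s s′
  avoiding-terminal s s′ s∈S s′∈S s≢s′ =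
    no-alternating-trail G col S A D tutte s∈S (terminal∉A G col S A D tutte s′∈S)
      (λ s⇝s′ → s≢s′ (at-most-one-terminal _
        (Reach-isComponent G A (terminal∉A G col S A D tutte s∈S)) s s′ s∈S s′∈S ε s⇝s′))
      (no-mismatch-at-terminal G col S A D tutte s′∈S)
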